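{- Let $P$ and $Q$ be two LTSs with the same signature $\{A^r,A^l,A^{bi}\}$, and let $p\in P$, $q\in Q$. Then $(P,p)\lesssim_{cc}(Q,q)$ if and only if $(\mathcal{C}(\mathcal{M}(P)),p)\lesssim_{cc}(\mathcal{C}(\mathcal{M}(Q)),q)$, where the signature of $\mathcal{C}(\mathcal{M}(P))$ and $\mathcal{C}(\mathcal{M}(Q))$ has an empty set of bivariant actions. (Thus checking whether two states are related by the covariant-contravariant simulation preorder can always be reduced to an equivalent check in a setting without bivariant actions.)
   Context: A modal transition system (MTS) over a set of actions $A$ is a triple $(P,\to_\Diamond,\to_\Box)$ with $P$ a set of states and $\to_\Box\subseteq\to_\Diamond\subseteq P\times A\times P$ (must transitions $\to_\Box$, may transitions $\to_\Diamond$). A labelled transition system (LTS) over $A$ is a set of states $P$ with a transition relation $\to\subseteq P\times A\times P$. A signature is a partition $\{A^r,A^l,A^{bi}\}$ of $A$ into pairwise disjoint, possibly empty sets (covariant, contravariant and bivariant actions). A covariant-contravariant simulation between LTSs $P$ and $Q$ with this signature is a relation $R\subseteq P\times Q$ such that whenever $p\,R\,q$: for all $a\in A^r\cup A^{bi}$ and $p\xrightarrow{a}p'$ there is $q\xrightarrow{a}q'$ with $p'\,R\,q'$; and for all $a\in A^l\cup A^{bi}$ and $q\xrightarrow{a}q'$ there is $p\xrightarrow{a}p'$ with $p'\,R\,q'$. Write $(P,p)\lesssim_{cc}(Q,q)$ if $p\,R\,q$ for some such $R$. For an LTS $P$ with signature $\{A^r,A^l,A^{bi}\}$, the MTS $\mathcal{M}(P)$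 over $A=A^r\cup A^l\cup A^{bi}$ has as states those of $P$ plus a new state $u$, and exactly the following transitions: $p\xrightarrow{a}_\Diamond p'$ for each $p\xrightarrow{a}p'$ in $P$; $p\xrightarrow{a}_\Box p'$ for each $p\xrightarrow{a}p'$ in $P$ with $a\in A^r\cup A^{bi}$; $p\xrightarrow{a}_\Diamond u$ for each $a\in A^r$ and state $p$ of $P$; $u\xrightarrow{a}_\Diamond u$ for each $a\in A$. For an MTS $M$ over $A$, the LTS $\mathcal{C}(M)$ has signature consisting of covariant actions $\{\mathrm{cv}(a)\mid a\in A\}$, contravariant actions $\{\mathrm{ct}(a)\mid a\in A\}$ and no bivariant actions (where $\mathrm{cv}(a),\mathrm{ct}(a)$ are two disjoint copies of the actions), the same states as $M$, and exactly the transitions $p\xrightarrow{\mathrm{ct}(a)}p'$ for each $p\xrightarrow{a}_\Diamond p'$ in $M$ and $p\xrightarrow{\mathrm{cv}(a)}p'$ for each $p\xrightarrow{a}_\Box p'$ in $M$. -}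

module Defs where

open import Data.Maybe.Base using (Maybe; just; nothing)
open import Data.Product.Base using (Σ; Σ-syntax; ∃-syntax; _×_; _,_)
open import Data.Sum.Base using (inj₁; inj₂)
open import Level using (Level; suc)
open import Relation.Binary.Core using (REL)
open import Relation.Unary using (Pred; Universal; _∈_; _∪_; _⊥_)
open import Relation.Unary.Polymorphic using (∅)

private
  variable
    ℓ : Level

-- Throughout, all sets and relations live in one arbitrary universe ℓ.

record LTS (A : Set ℓ) : Set (suc ℓ) where
  field
    State : Set ℓ
    Trans : State → A → State → Set ℓ

record MTS (A : Set ℓ) : Set (suc ℓ) where
  field
    State    : Set ℓ
    May      : State → A → State → Set ℓ
    Must     : State → A → State → Set ℓ
    must⇒may : ∀ {p a p′} → Must p a p′ → May p a p′

-- A partition of A into three possibly empty parts. The parts need not be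
-- proof-irrelevant, but `cover` decides to which part an action belongs.

record Signature (A : Set ℓ) : Set (suc ℓ) where
  field
    Aʳ Aˡ Aᵇⁱ : Pred A ℓ
    cover     : Universal (Aʳ ∪ Aˡ ∪ Aᵇⁱ)
    r⊥l       : Aʳ ⊥ Aˡ
    r⊥bi      : Aʳ ⊥ Aᵇⁱ
    l⊥bi      : Aˡ ⊥ Aᵇⁱ

module _ {A : Set ℓ} (S : Signature A) (P Q : LTS A) where
  open Signature S
  private
    module P = LTS P
    module Q = LTS Q

  record IsCCSimulation (R : REL P.State Q.State ℓ) : Set ℓ where
    field
      forth : ∀ {p q} → R p q → ∀ {a p′} → a ∈ Aʳ ∪ Aᵇⁱ → P.Trans p a p′ →
              ∃[ q′ ] Q.Trans q a q′ × R p′ q′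
      back  : ∀ {p q} → R p q → ∀ {a q′} → a ∈ Aˡ ∪ Aᵇⁱ → Q.Trans q a q′ →
              ∃[ p′ ] P.Trans p a p′ × R p′ q′

infix 4 _⊢_≲cc_

_⊢_≲cc_ : {A : Set ℓ} → Signature A →
          Σ (LTS A) LTS.State → Σ (LTS A) LTS.State → Set (suc ℓ)
_⊢_≲cc_ {ℓ} S (P , p) (Q , q) =
  Σ[ R ∈ REL (LTS.State P) (LTS.State Q) ℓ ] IsCCSimulation S P Q R × R p q

-- The new state u is `nothing`; a state p of P becomes `just p`.

pattern u = nothing

module _ {A : Set ℓ} (S : Signature A) (P : LTS A) where
  open Signature S
  open LTS P

  data ℳ-May : Maybe State → A → Maybe State → Set ℓ where
    trans : ∀ {p a p′} → Trans p a p′ → ℳ-May (just p) a (just p′)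
    to-u  : ∀ {p a} → a ∈ Aʳ → ℳ-May (just p) a u
    u-u   : ∀ {a} → ℳ-May u a u

  data ℳ-Must : Maybe State → A → Maybe State → Set ℓ where
    trans : ∀ {p a p′} → a ∈ Aʳ ∪ Aᵇⁱ → Trans p a p′ →
            ℳ-Must (just p) a (just p′)

  ℳ : MTS A
  ℳ = record
    { State    = Maybe State
    ; May      = ℳ-May
    ; Must     = ℳ-Must
    ; must⇒may = λ { (trans _ t) → trans t }
    }

data 𝒞-Action (A : Set ℓ) : Set ℓ where
  cv ct : A → 𝒞-Action A

data IsCv {A : Set ℓ} : Pred (𝒞-Action A) ℓ where
  isCv : ∀ a → IsCv (cv a)

data IsCt {A : Set ℓ} : Pred (𝒞-Action A) ℓ where
  isCt : ∀ a → IsCt (ct a)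

𝒞-Signature : (A : Set ℓ) → Signature (𝒞-Action A)
𝒞-Signature A = record
  { Aʳ    = IsCv
  ; Aˡ    = IsCt
  ; Aᵇⁱ   = ∅
  ; cover = λ { (cv a) → inj₁ (isCv a) ; (ct a) → inj₂ (inj₁ (isCt a)) }
  ; r⊥l   = λ { (isCv _ , ()) }
  ; r⊥bi  = λ { (_ , ()) }
  ; l⊥bi  = λ { (_ , ()) }
  }

module _ {A : Set ℓ} (M : MTS A) where
  open MTS M

  data 𝒞-Trans : State → 𝒞-Action A → State → Set ℓ where
    may  : ∀ {p a p′} → May p a p′ → 𝒞-Trans p (ct a) p′
    must : ∀ {p a p′} → Must p a p′ → 𝒞-Trans p (cv a) p′

  𝒞 : LTS (𝒞-Action A)
  𝒞 = record { State = State ; Trans = 𝒞-Trans }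

{-# OPTIONS --safe #-}

-- In ℳ(P) the state u has no must transitions and loops under every action, so
-- it is below every state. A simulation R therefore extends by relating u to
-- everything: a covariant may transition on the right is always answered by a
-- step to u. Conversely, u cannot answer a contravariant or bivariant
-- transition, so a simulation between the translations restricts to P and Q.

module Submission where

open import Data.Empty.Polymorphic using (⊥)
open import Data.Maybe.Base using (Maybe; just)
open import Data.Product.Base using (_,_; ∃-syntax; _×_)
open import Data.Sum.Base using (inj₁; inj₂)
open import Data.Unit.Polymorphic using (⊤)
open import Function.Bundles using (_⇔_; mk⇔)
open import Level using (Level)
open import Relation.Binary.Core using (REL)
open import Relation.Nullary.Negation using (contradiction)
open import Relation.Unary using (_∈_; _∉_; _∪_)
open import Defs

private
  variable
    ℓ : Level

-- The last clause is empty because `u` has no must transition with which to answer one of `x`.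
extend : {X Y : Set ℓ} → REL X Y ℓ → REL (Maybe X) (Maybe Y) ℓ
extend R u        _        = ⊤
extend R (just x) (just y) = R x y
extend R (just x) u        = ⊥

restrict : {X Y : Set ℓ} → REL (Maybe X) (Maybe Y) ℓ → REL X Y ℓ
restrict R x y = R (just x) (just y)

module _ {A : Set ℓ} (S : Signature A) where
  open Signature S

  lbi⇒∉r : ∀ {a} → a ∈ Aˡ ∪ Aᵇⁱ → a ∉ Aʳ
  lbi⇒∉r (inj₁ l)  r = r⊥l (r , l)
  lbi⇒∉r (inj₂ bi) r = r⊥bi (r , bi)

  module _ (P Q : LTS A) where
    private
      module P = LTS P
      module Q = LTS Q
      𝒞ℳP = 𝒞 (ℳ S P)
      𝒞ℳQ = 𝒞 (ℳ S Q)

    extend-isCCSimulation : {R : REL P.State Q.State ℓ} → IsCCSimulation S P Q R →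
                            IsCCSimulation (𝒞-Signature A) 𝒞ℳP 𝒞ℳQ (extend R)
    extend-isCCSimulation {R} sim = record { forth = forth′ ; back = back′ }
      where
      open IsCCSimulation sim

      forth′ : ∀ {x y} → extend R x y → ∀ {b x′} → _ → 𝒞-Trans (ℳ S P) x b x′ →
               ∃[ y′ ] 𝒞-Trans (ℳ S Q) y b y′ × extend R x′ y′
      -- Only this case arises: `u` has no must transitions, and no `just` is related to `u`.
      forth′ {just _} {just _} r (inj₁ (isCv _)) (must (trans a∈rbi t))
        with q′ , t′ , r′ ← forth r a∈rbi t = just q′ , must (trans a∈rbi t′) , r′

      back′ : ∀ {x y} → extend R x y → ∀ {b y′} → _ → 𝒞-Trans (ℳ S Q) y b y′ →
              ∃[ x′ ] 𝒞-Trans (ℳ S P) x b x′ × extend R x′ y′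
      back′ {u}               _ (inj₁ (isCt _)) _              = u , may u-u , _
      back′ {just _} {just _} _ (inj₁ (isCt _)) (may (to-u r)) = u , may (to-u r) , _
      -- Every may transition has to be answered, but `back` serves only contravariant and bivariant
      -- actions, hence the case split by `cover`.
      back′ {just _} {just _} r (inj₁ (isCt a)) (may (trans t)) with cover a
      ... | inj₁ a∈r = u , may (to-u a∈r) , _
      ... | inj₂ a∈lbi
        with p′ , t′ , r′ ← back r a∈lbi t = just p′ , may (trans t′) , r′

    restrict-isCCSimulation : {R : REL (Maybe P.State) (Maybe Q.State) ℓ} →
                              IsCCSimulation (𝒞-Signature A) 𝒞ℳP 𝒞ℳQ R →
                              IsCCSimulation S P Q (restrict R)
    restrict-isCCSimulation {R} sim = record { forth = forth′ ; back = back′ }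
      where
      open IsCCSimulation sim

      forth′ : ∀ {p q} → restrict R p q → ∀ {a p′} → a ∈ Aʳ ∪ Aᵇⁱ → P.Trans p a p′ →
               ∃[ q′ ] Q.Trans q a q′ × restrict R p′ q′
      forth′ r {a} a∈rbi t with forth r (inj₁ (isCv a)) (must (trans a∈rbi t))
      -- A must transition never ends in `u`, so the answer is a transition of `Q`.
      ... | just q′ , must (trans _ t′) , r′ = q′ , t′ , r′

      back′ : ∀ {p q} → restrict R p q → ∀ {a q′} → a ∈ Aˡ ∪ Aᵇⁱ → Q.Trans q a q′ →
              ∃[ p′ ] P.Trans p a p′ × restrict R p′ q′
      back′ r {a} a∈lbi t with back r (inj₁ (isCt a)) (may (trans t))
      ... | just p′ , may (trans t′)  , r′ = p′ , t′ , r′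
      -- A state of `P` reaches `u` only by `to-u`, which makes the action covariant, against the
      -- disjointness of the signature.
      ... | u       , may (to-u a∈r) , _  = contradiction a∈r (lbi⇒∉r a∈lbi)

mainTheorem7 : {ℓ : Level} {A : Set ℓ} (S : Signature A) (P Q : LTS A)
    (p : LTS.State P) (q : LTS.State Q) →
    (S ⊢ (P , p) ≲cc (Q , q)) ⇔ (𝒞-Signature A ⊢ (𝒞 (ℳ S P) , just p) ≲cc (𝒞 (ℳ S Q) , just q))
mainTheorem7 S P Q p q = mk⇔
  (λ (R , sim , r) → extend R , extend-isCCSimulation S P Q sim , r)
  (λ (R , sim , r) → restrict R , restrict-isCCSimulation S P Q sim , r)
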